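{- The flattening conjecture is false. That is, for all constants $0<c\le C$ there exist positive integers $n,k$, a real $\alpha>0$, and probability distributions $q_1,\dots,q_k\in\Delta([n])$ with $\|q_j-q_{j'}\|_1\le 2\alpha$ for all $j,j'$, such that there do not exist a positive integer $m$ and a randomized map $\phi:[n]\to[m]$ satisfying both of the following: 1. for all $1\le j\le k$ and $y\in[m]$, $\frac{1-\alpha}{m}\le\phi q_j(y)\le\frac{1+\alpha}{m}$; 2. for all $1\le j<j'\le k$, $c\,\|q_j-q_{j'}\|_1\le\|\phi q_j-\phi q_{j'}\|_1\le C\,\|q_j-q_{j'}\|_1$.
   Context: $[n]=\{1,\dots,n\}$ and $\Delta([n])$ is the set of probability distributions on $[n]$, identified with their mass functions. A randomized map $\phi:[n]\to[m]$ assigns to each $x\in[n]$ a random element of $[m]$ (equivalently, it is a column-stochastic matrix in $\mathbb{R}^{m\times n}$). For $q\in\Delta([n])$, $\phi q\in\Delta([m])$ is the distribution of $\phi(x)$ when $x\sim q$. $\|\cdot\|_1$ is the $\ell_1$ norm of mass functions. -}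

module Defs where

open import Algebra.Bundles using (CommutativeRing)
open import Algebra.Structures using (IsCommutativeRing)
open import Data.Fin.Base using (Fin)
open import Data.Integer.Base using (+_)
open import Data.Nat.Base as ℕ using (ℕ; zero; suc)
import Data.Nat.Properties as ℕ
open import Data.Product.Base using (∃; _×_; _,_)
open import Data.Rational.Base as ℚ using (ℚ; 0ℚ; 1ℚ; ½)
import Data.Rational.Properties as ℚ
open import Data.Rational.Solver using (module +-*-Solver)
open import Data.Sum.Base using (inj₁; inj₂)
open import Data.Vec.Functional using (Vector)
open import Level using (0ℓ)
open import Relation.Binary.Structures using (IsEquivalence)
open import Relation.Binary.PropositionalEquality using (_≡_; refl; sym; trans; cong; cong₂; subst; subst₂)

open +-*-Solver using (solve; _:+_; _:*_; _:-_; :-_; _:=_; con)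

-- The standard library has no real numbers.  A real is represented by a
-- Cauchy sequence of rationals, with the usual (setoid) equality _≃_.

Eventually : (ℕ → Set) → Set
Eventually P = ∃ λ N → ∀ n → N ℕ.≤ n → P n

record ℝ : Set where
  no-eta-equality
  field
    seq    : ℕ → ℚ
    cauchy : ∀ ε → 0ℚ ℚ.< ε → ∃ λ N → ∀ m n → N ℕ.≤ m → N ℕ.≤ n →
             ℚ.∣ seq m ℚ.- seq n ∣ ℚ.≤ ε
open ℝ public

infix 4 _≃_ _≤_ _<_

-- The relations are records rather than functions so that x and y can be
-- inferred from a proof.
record _≃_ (x y : ℝ) : Set where
  constructor mk≃
  field run≃ : ∀ ε → 0ℚ ℚ.< ε → Eventually λ n → ℚ.∣ seq x n ℚ.- seq y n ∣ ℚ.≤ ε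
open _≃_ public

record _≤_ (x y : ℝ) : Set where
  constructor mk≤
  field run≤ : ∀ ε → 0ℚ ℚ.< ε → Eventually λ n → seq x n ℚ.≤ seq y n ℚ.+ ε
open _≤_ public

record _<_ (x y : ℝ) : Set where
  constructor mk<
  field run< : ∃ λ ε → 0ℚ ℚ.< ε × Eventually λ n → seq x n ℚ.+ ε ℚ.≤ seq y n
open _<_ public

module Lemmas where
  ∧-eventually : ∀ {P Q : ℕ → Set} → Eventually P → Eventually Q →
                 Eventually λ n → P n × Q n
  ∧-eventually (M , p) (N , q) =
    M ℕ.⊔ N , λ n h → p n (ℕ.m⊔n≤o⇒m≤o M N h) , q n (ℕ.m⊔n≤o⇒n≤o M N h)

  map-eventually : ∀ {P Q : ℕ → Set} → (∀ n → P n → Q n) → Eventually P → Eventually Q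
  map-eventually f (N , p) = N , λ n h → f n (p n h)

  half-pos : ∀ {ε} → 0ℚ ℚ.< ε → 0ℚ ℚ.< ½ ℚ.* ε
  half-pos {ε} 0<ε = subst (ℚ._< ½ ℚ.* ε) (ℚ.*-zeroʳ ½) (ℚ.*-monoʳ-<-pos ½ 0<ε)

  half+half : ∀ ε → ½ ℚ.* ε ℚ.+ ½ ℚ.* ε ≡ ε
  half+half = solve 1 (λ e → con ½ :* e :+ con ½ :* e := e) refl

  divide : ∀ {ε B} → 0ℚ ℚ.< ε → 0ℚ ℚ.< B → ∃ λ δ → 0ℚ ℚ.< δ × δ ℚ.* B ≡ ε
  divide {ε} {B} 0<ε 0<B = ε ℚ.* ℚ.1/ B , 0<δ , eq
    where
    instance
      B-pos : ℚ.Positive B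
      B-pos = ℚ.positive 0<B
      B-nz : ℚ.NonZero B
      B-nz = ℚ.pos⇒nonZero B
      1/B-pos : ℚ.Positive (ℚ.1/ B)
      1/B-pos = ℚ.1/pos⇒pos B
    0<δ : 0ℚ ℚ.< ε ℚ.* ℚ.1/ B
    0<δ = subst (ℚ._< ε ℚ.* ℚ.1/ B) (ℚ.*-zeroˡ (ℚ.1/ B)) (ℚ.*-monoˡ-<-pos (ℚ.1/ B) 0<ε)
    eq : ε ℚ.* ℚ.1/ B ℚ.* B ≡ ε
    eq = trans (ℚ.*-assoc ε (ℚ.1/ B) B)
               (trans (cong (ε ℚ.*_) (ℚ.*-inverseˡ B)) (ℚ.*-identityʳ ε))

  p≤∣p∣ : ∀ p → p ℚ.≤ ℚ.∣ p ∣
  p≤∣p∣ p with ℚ.≤-total 0ℚ p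
  ... | inj₁ 0≤p = ℚ.≤-reflexive (sym (ℚ.0≤p⇒∣p∣≡p 0≤p))
  ... | inj₂ p≤0 = ℚ.≤-trans p≤0 (ℚ.0≤∣p∣ p)

  ∣-∣-least : ∀ {p r} → p ℚ.≤ r → ℚ.- p ℚ.≤ r → ℚ.∣ p ∣ ℚ.≤ r
  ∣-∣-least {p} h₁ h₂ with ℚ.∣p∣≡p∨∣p∣≡-p p
  ... | inj₁ eq rewrite eq = h₁
  ... | inj₂ eq rewrite eq = h₂

  dist-sym : ∀ p q → ℚ.∣ p ℚ.- q ∣ ≡ ℚ.∣ q ℚ.- p ∣
  dist-sym p q = trans (sym (ℚ.∣-p∣≡∣p∣ (p ℚ.- q)))
    (cong ℚ.∣_∣ (solve 2 (λ p q → :- (p :- q) := q :- p) refl p q))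

  dist-triangle : ∀ p q r → ℚ.∣ p ℚ.- r ∣ ℚ.≤ ℚ.∣ p ℚ.- q ∣ ℚ.+ ℚ.∣ q ℚ.- r ∣
  dist-triangle p q r = subst (ℚ._≤ ℚ.∣ p ℚ.- q ∣ ℚ.+ ℚ.∣ q ℚ.- r ∣)
    (cong ℚ.∣_∣ (solve 3 (λ p q r → (p :- q) :+ (q :- r) := p :- r) refl p q r))
    (ℚ.∣p+q∣≤∣p∣+∣q∣ (p ℚ.- q) (q ℚ.- r))

  abs-shift : ∀ p q → ℚ.∣ p ∣ ℚ.≤ ℚ.∣ p ℚ.- q ∣ ℚ.+ ℚ.∣ q ∣
  abs-shift p q = subst (ℚ._≤ ℚ.∣ p ℚ.- q ∣ ℚ.+ ℚ.∣ q ∣)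
    (cong ℚ.∣_∣ (solve 2 (λ p q → (p :- q) :+ q := p) refl p q))
    (ℚ.∣p+q∣≤∣p∣+∣q∣ (p ℚ.- q) q)

  add-close : ∀ {ε} a a′ b b′ →
    ℚ.∣ a ℚ.- a′ ∣ ℚ.≤ ½ ℚ.* ε → ℚ.∣ b ℚ.- b′ ∣ ℚ.≤ ½ ℚ.* ε →
    ℚ.∣ (a ℚ.+ b) ℚ.- (a′ ℚ.+ b′) ∣ ℚ.≤ ε
  add-close {ε} a a′ b b′ h k = begin
    ℚ.∣ (a ℚ.+ b) ℚ.- (a′ ℚ.+ b′) ∣
      ≡⟨ cong ℚ.∣_∣ (solve 4 (λ a a′ b b′ →
           (a :+ b) :- (a′ :+ b′) := (a :- a′) :+ (b :- b′)) refl a a′ b b′) ⟩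
    ℚ.∣ (a ℚ.- a′) ℚ.+ (b ℚ.- b′) ∣
      ≤⟨ ℚ.∣p+q∣≤∣p∣+∣q∣ (a ℚ.- a′) (b ℚ.- b′) ⟩
    ℚ.∣ a ℚ.- a′ ∣ ℚ.+ ℚ.∣ b ℚ.- b′ ∣
      ≤⟨ ℚ.+-mono-≤ h k ⟩
    ½ ℚ.* ε ℚ.+ ½ ℚ.* ε
      ≡⟨ half+half ε ⟩
    ε ∎
    where open ℚ.≤-Reasoning

  neg-close : ∀ a b → ℚ.∣ ℚ.- a ℚ.- ℚ.- b ∣ ≡ ℚ.∣ a ℚ.- b ∣
  neg-close a b = trans
    (cong ℚ.∣_∣ (solve 2 (λ a b → (:- a) :- (:- b) := :- (a :- b)) refl a b))
    (ℚ.∣-p∣≡∣p∣ (a ℚ.- b))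

  *-mono-≤ : ∀ {a b c d} → 0ℚ ℚ.≤ b → 0ℚ ℚ.≤ c → a ℚ.≤ c → b ℚ.≤ d →
             a ℚ.* b ℚ.≤ c ℚ.* d
  *-mono-≤ {a} {b} {c} {d} 0≤b 0≤c a≤c b≤d = ℚ.≤-trans
    (ℚ.*-monoʳ-≤-nonNeg b {{ℚ.nonNegative 0≤b}} a≤c)
    (ℚ.*-monoˡ-≤-nonNeg c {{ℚ.nonNegative 0≤c}} b≤d)

  mul-close : ∀ {A B δ} a a′ b b′ → 0ℚ ℚ.≤ δ → 0ℚ ℚ.≤ A →
    ℚ.∣ a ∣ ℚ.≤ A → ℚ.∣ b′ ∣ ℚ.≤ B →
    ℚ.∣ a ℚ.- a′ ∣ ℚ.≤ δ → ℚ.∣ b ℚ.- b′ ∣ ℚ.≤ δ →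
    ℚ.∣ a ℚ.* b ℚ.- a′ ℚ.* b′ ∣ ℚ.≤ δ ℚ.* (A ℚ.+ B)
  mul-close {A} {B} {δ} a a′ b b′ 0≤δ 0≤A ha hb h k = begin
    ℚ.∣ a ℚ.* b ℚ.- a′ ℚ.* b′ ∣
      ≡⟨ cong ℚ.∣_∣ (solve 4 (λ a a′ b b′ →
           a :* b :- a′ :* b′ := a :* (b :- b′) :+ (a :- a′) :* b′) refl a a′ b b′) ⟩
    ℚ.∣ a ℚ.* (b ℚ.- b′) ℚ.+ (a ℚ.- a′) ℚ.* b′ ∣
      ≤⟨ ℚ.∣p+q∣≤∣p∣+∣q∣ (a ℚ.* (b ℚ.- b′)) ((a ℚ.- a′) ℚ.* b′) ⟩
    ℚ.∣ a ℚ.* (b ℚ.- b′) ∣ ℚ.+ ℚ.∣ (a ℚ.- a′) ℚ.* b′ ∣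
      ≡⟨ cong₂ ℚ._+_ (ℚ.∣p*q∣≡∣p∣*∣q∣ a (b ℚ.- b′)) (ℚ.∣p*q∣≡∣p∣*∣q∣ (a ℚ.- a′) b′) ⟩
    ℚ.∣ a ∣ ℚ.* ℚ.∣ b ℚ.- b′ ∣ ℚ.+ ℚ.∣ a ℚ.- a′ ∣ ℚ.* ℚ.∣ b′ ∣
      ≤⟨ ℚ.+-mono-≤ (*-mono-≤ (ℚ.0≤∣p∣ (b ℚ.- b′)) 0≤A ha k)
                    (*-mono-≤ (ℚ.0≤∣p∣ b′) 0≤δ h hb) ⟩
    A ℚ.* δ ℚ.+ δ ℚ.* B
      ≡⟨ solve 3 (λ A B δ → A :* δ :+ δ :* B := δ :* (A :+ B)) refl A B δ ⟩
    δ ℚ.* (A ℚ.+ B) ∎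
    where open ℚ.≤-Reasoning

  bounded : ∀ x → ∃ λ B → 0ℚ ℚ.< B × Eventually λ n → ℚ.∣ seq x n ∣ ℚ.≤ B
  bounded x with cauchy x 1ℚ (ℚ.positive⁻¹ 1ℚ)
  ... | N , h = 1ℚ ℚ.+ ℚ.∣ seq x N ∣
              , ℚ.<-≤-trans (ℚ.positive⁻¹ 1ℚ)
                  (subst (ℚ._≤ 1ℚ ℚ.+ ℚ.∣ seq x N ∣) (ℚ.+-identityʳ 1ℚ)
                    (ℚ.+-monoʳ-≤ 1ℚ (ℚ.0≤∣p∣ (seq x N))))
              , N , λ n N≤n → ℚ.≤-trans (abs-shift (seq x n) (seq x N))
                  (ℚ.+-monoˡ-≤ ℚ.∣ seq x N ∣ (h n N N≤n ℕ.≤-refl))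

  +-pos : ∀ {p q} → 0ℚ ℚ.< p → 0ℚ ℚ.< q → 0ℚ ℚ.< p ℚ.+ q
  +-pos {p} {q} h k = subst (ℚ._< p ℚ.+ q) (ℚ.+-identityʳ 0ℚ) (ℚ.+-mono-< h k)

  abs-close : ∀ p q → ℚ.∣ ℚ.∣ p ∣ ℚ.- ℚ.∣ q ∣ ∣ ℚ.≤ ℚ.∣ p ℚ.- q ∣
  abs-close p q = ∣-∣-least (move ℚ.∣ p ∣ ℚ.∣ q ∣ (abs-shift p q))
    (subst (ℚ._≤ ℚ.∣ p ℚ.- q ∣)
      (solve 2 (λ a b → b :- a := :- (a :- b)) refl ℚ.∣ p ∣ ℚ.∣ q ∣)
      (move ℚ.∣ q ∣ ℚ.∣ p ∣
        (subst (λ r → ℚ.∣ q ∣ ℚ.≤ r ℚ.+ ℚ.∣ p ∣) (dist-sym q p) (abs-shift q p))))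
    where
    move : ∀ a b {c} → a ℚ.≤ c ℚ.+ b → a ℚ.- b ℚ.≤ c
    move a b {c} h = subst (a ℚ.- b ℚ.≤_)
      (solve 2 (λ c b → (c :+ b) :- b := c) refl c b)
      (ℚ.+-monoˡ-≤ (ℚ.- b) h)

  dist-refl : ∀ {p q ε} → p ≡ q → 0ℚ ℚ.< ε → ℚ.∣ p ℚ.- q ∣ ℚ.≤ ε
  dist-refl {p} {ε = ε} refl 0<ε =
    subst (ℚ._≤ ε) (sym (cong ℚ.∣_∣ (ℚ.+-inverseʳ p))) (ℚ.<⇒≤ 0<ε)

open Lemmas

infixl 6 _+_ _-_
infixl 7 _*_ _/_
infix  8 -_

fromℚ : ℚ → ℝ
fromℚ p .seq    _     = p
fromℚ p .cauchy ε 0<ε = 0 , λ _ _ _ _ → dist-refl {p} refl 0<ε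

0ℝ 1ℝ 2ℝ : ℝ
0ℝ = fromℚ 0ℚ
1ℝ = fromℚ 1ℚ
2ℝ = fromℚ (+ 2 ℚ./ 1)

_+_ : ℝ → ℝ → ℝ
(x + y) .seq    n     = seq x n ℚ.+ seq y n
(x + y) .cauchy ε 0<ε =
  let M , h = cauchy x (½ ℚ.* ε) (half-pos 0<ε)
      N , k = cauchy y (½ ℚ.* ε) (half-pos 0<ε)
  in M ℕ.⊔ N , λ m n hm hn →
     add-close (seq x m) (seq x n) (seq y m) (seq y n)
       (h m n (ℕ.m⊔n≤o⇒m≤o M N hm) (ℕ.m⊔n≤o⇒m≤o M N hn))
       (k m n (ℕ.m⊔n≤o⇒n≤o M N hm) (ℕ.m⊔n≤o⇒n≤o M N hn))

-_ : ℝ → ℝ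
(- x) .seq    n     = ℚ.- seq x n
(- x) .cauchy ε 0<ε =
  let N , h = cauchy x ε 0<ε
  in N , λ m n hm hn →
     subst (ℚ._≤ ε) (sym (neg-close (seq x m) (seq x n))) (h m n hm hn)

_-_ : ℝ → ℝ → ℝ
x - y = x + - y

∣_∣ : ℝ → ℝ
∣ x ∣ .seq    n     = ℚ.∣ seq x n ∣
∣ x ∣ .cauchy ε 0<ε =
  let N , h = cauchy x ε 0<ε
  in N , λ m n hm hn → ℚ.≤-trans (abs-close (seq x m) (seq x n)) (h m n hm hn)

_*_ : ℝ → ℝ → ℝ
(x * y) .seq    n     = seq x n ℚ.* seq y n
(x * y) .cauchy ε 0<ε =
  let A , 0<A , K , ha = bounded x
      B , 0<B , L , hb = bounded y
      δ , 0<δ , eq     = divide 0<ε (+-pos 0<A 0<B)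
      M , h = cauchy x δ 0<δ
      N , k = cauchy y δ 0<δ
      KL = K ℕ.⊔ L
      MN = M ℕ.⊔ N
  in KL ℕ.⊔ MN , λ m n hm hn →
     let m₁ = ℕ.m⊔n≤o⇒m≤o KL MN hm
         n₁ = ℕ.m⊔n≤o⇒m≤o KL MN hn
         m₂ = ℕ.m⊔n≤o⇒n≤o KL MN hm
         n₂ = ℕ.m⊔n≤o⇒n≤o KL MN hn
     in subst (ℚ.∣ seq x m ℚ.* seq y m ℚ.- seq x n ℚ.* seq y n ∣ ℚ.≤_) eq
          (mul-close (seq x m) (seq x n) (seq y m) (seq y n)
            (ℚ.<⇒≤ 0<δ) (ℚ.<⇒≤ 0<A)
            (ha m (ℕ.m⊔n≤o⇒m≤o K L m₁)) (hb n (ℕ.m⊔n≤o⇒n≤o K L n₁))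
            (h m n (ℕ.m⊔n≤o⇒m≤o M N m₂) (ℕ.m⊔n≤o⇒m≤o M N n₂))
            (k m n (ℕ.m⊔n≤o⇒n≤o M N m₂) (ℕ.m⊔n≤o⇒n≤o M N n₂)))

_/_ : ℝ → (m : ℕ) → .{{ℕ.NonZero m}} → ℝ
x / m = x * fromℚ (+ 1 ℚ./ m)

pointwise⇒≃ : ∀ {x y} → (∀ n → seq x n ≡ seq y n) → x ≃ y
pointwise⇒≃ h = mk≃ λ ε 0<ε → 0 , λ n _ → dist-refl (h n) 0<ε

≃-isEquivalence : IsEquivalence _≃_
≃-isEquivalence = record
  { refl  = pointwise⇒≃ λ _ → refl
  ; sym   = λ {x} {y} h → mk≃ λ ε 0<ε → map-eventually
              (λ n → subst (ℚ._≤ ε) (dist-sym (seq x n) (seq y n))) (run≃ h ε 0<ε)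
  ; trans = λ {x} {y} {z} h k → mk≃ λ ε 0<ε → map-eventually
              (λ n (p , q) → ℚ.≤-trans (dist-triangle (seq x n) (seq y n) (seq z n))
                 (ℚ.≤-trans (ℚ.+-mono-≤ p q) (ℚ.≤-reflexive (half+half ε))))
              (∧-eventually (run≃ h (½ ℚ.* ε) (half-pos 0<ε)) (run≃ k (½ ℚ.* ε) (half-pos 0<ε)))
  }

+-cong : ∀ {x x′ y y′} → x ≃ x′ → y ≃ y′ → x + y ≃ x′ + y′
+-cong {x} {x′} {y} {y′} h k = mk≃ λ ε 0<ε → map-eventually
  (λ n (p , q) → add-close (seq x n) (seq x′ n) (seq y n) (seq y′ n) p q)
  (∧-eventually (run≃ h (½ ℚ.* ε) (half-pos 0<ε)) (run≃ k (½ ℚ.* ε) (half-pos 0<ε)))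

*-cong : ∀ {x x′ y y′} → x ≃ x′ → y ≃ y′ → x * y ≃ x′ * y′
*-cong {x} {x′} {y} {y′} h k = mk≃ λ ε 0<ε →
  let A , 0<A , ha = bounded x
      B , 0<B , hb = bounded y′
      δ , 0<δ , eq = divide 0<ε (+-pos 0<A 0<B)
  in map-eventually
       (λ n ((a , b) , (p , q)) →
          subst (ℚ.∣ seq x n ℚ.* seq y n ℚ.- seq x′ n ℚ.* seq y′ n ∣ ℚ.≤_) eq
            (mul-close (seq x n) (seq x′ n) (seq y n) (seq y′ n)
              (ℚ.<⇒≤ 0<δ) (ℚ.<⇒≤ 0<A) a b p q))
       (∧-eventually (∧-eventually ha hb) (∧-eventually (run≃ h δ 0<δ) (run≃ k δ 0<δ)))

-‿cong : ∀ {x y} → x ≃ y → - x ≃ - y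
-‿cong {x} {y} h = mk≃ λ ε 0<ε → map-eventually
  (λ n → subst (ℚ._≤ ε) (sym (neg-close (seq x n) (seq y n)))) (run≃ h ε 0<ε)

+-*-isCommutativeRing : IsCommutativeRing _≃_ _+_ _*_ -_ 0ℝ 1ℝ
+-*-isCommutativeRing = record
  { isRing = record
    { +-isAbelianGroup = record
      { isGroup = record
        { isMonoid = record
          { isSemigroup = record
            { isMagma = record
              { isEquivalence = ≃-isEquivalence
              ; ∙-cong = +-cong
              }
            ; assoc = λ x y z → pointwise⇒≃
                        λ n → ℚ.+-assoc (seq x n) (seq y n) (seq z n)
            }
          ; identity = (λ x → pointwise⇒≃ λ n → ℚ.+-identityˡ (seq x n))
                     , (λ x → pointwise⇒≃ λ n → ℚ.+-identityʳ (seq x n))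
          }
        ; inverse = (λ x → pointwise⇒≃ λ n → ℚ.+-inverseˡ (seq x n))
                  , (λ x → pointwise⇒≃ λ n → ℚ.+-inverseʳ (seq x n))
        ; ⁻¹-cong = -‿cong
        }
      ; comm = λ x y → pointwise⇒≃ λ n → ℚ.+-comm (seq x n) (seq y n)
      }
    ; *-cong = *-cong
    ; *-assoc = λ x y z → pointwise⇒≃
                  λ n → ℚ.*-assoc (seq x n) (seq y n) (seq z n)
    ; *-identity = (λ x → pointwise⇒≃ λ n → ℚ.*-identityˡ (seq x n))
                 , (λ x → pointwise⇒≃ λ n → ℚ.*-identityʳ (seq x n))
    ; distrib = (λ x y z → pointwise⇒≃
                   λ n → ℚ.*-distribˡ-+ (seq x n) (seq y n) (seq z n))
              , (λ x y z → pointwise⇒≃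
                   λ n → ℚ.*-distribʳ-+ (seq x n) (seq y n) (seq z n))
    }
  ; *-comm = λ x y → pointwise⇒≃ λ n → ℚ.*-comm (seq x n) (seq y n)
  }

+-*-commutativeRing : CommutativeRing 0ℓ 0ℓ
+-*-commutativeRing = record { isCommutativeRing = +-*-isCommutativeRing }

open CommutativeRing +-*-commutativeRing using (semiring; setoid)
open import Algebra.Properties.Semiring.Sum semiring public
  using (sum; sum-syntax; sum-cong-≋; ∑-comm; *-distribˡ-sum)

nonNeg⇒∣x∣≃x : ∀ {x} → 0ℝ ≤ x → ∣ x ∣ ≃ x
nonNeg⇒∣x∣≃x {x} h = mk≃ λ ε 0<ε →
  map-eventually (λ n → close ε 0<ε (seq x n)) (run≤ h (½ ℚ.* ε) (half-pos 0<ε))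
  where
  -- ∣p∣ - p is 0 or -2p
  close : ∀ ε → 0ℚ ℚ.< ε → ∀ p → 0ℚ ℚ.≤ p ℚ.+ ½ ℚ.* ε → ℚ.∣ ℚ.∣ p ∣ ℚ.- p ∣ ℚ.≤ ε
  close ε 0<ε p k with ℚ.∣p∣≡p∨∣p∣≡-p p
  ... | inj₁ eq = dist-refl eq 0<ε
  ... | inj₂ eq = subst (ℚ._≤ ε) (sym (ℚ.0≤p⇒∣p∣≡p 0≤d)) d≤ε
    where
    0≤d : 0ℚ ℚ.≤ ℚ.∣ p ∣ ℚ.- p
    0≤d = subst (ℚ._≤ ℚ.∣ p ∣ ℚ.- p) (ℚ.+-inverseʳ p) (ℚ.+-monoˡ-≤ (ℚ.- p) (p≤∣p∣ p))
    -p≤ : ℚ.- p ℚ.≤ ½ ℚ.* ε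
    -p≤ = subst₂ ℚ._≤_ (ℚ.+-identityˡ (ℚ.- p))
            (solve 2 (λ p e → (p :+ e) :- p := e) refl p (½ ℚ.* ε))
            (ℚ.+-monoˡ-≤ (ℚ.- p) k)
    d≤ε : ℚ.∣ p ∣ ℚ.- p ℚ.≤ ε
    d≤ε = subst (λ r → r ℚ.- p ℚ.≤ ε) (sym eq)
            (ℚ.≤-trans (ℚ.+-mono-≤ -p≤ -p≤) (ℚ.≤-reflexive (half+half ε)))

∣x∣≃x⇒nonNeg : ∀ {x} → ∣ x ∣ ≃ x → 0ℝ ≤ x
∣x∣≃x⇒nonNeg {x} h = mk≤ λ ε 0<ε → map-eventually (λ n → bound ε (seq x n)) (run≃ h ε 0<ε)
  where
  bound : ∀ ε p → ℚ.∣ ℚ.∣ p ∣ ℚ.- p ∣ ℚ.≤ ε → 0ℚ ℚ.≤ p ℚ.+ ε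
  bound ε p k = ℚ.≤-trans (ℚ.0≤∣p∣ p) (subst (ℚ._≤ p ℚ.+ ε)
    (solve 2 (λ p a → p :+ (a :- p) := a) refl p ℚ.∣ p ∣)
    (ℚ.+-monoʳ-≤ p (ℚ.≤-trans (p≤∣p∣ (ℚ.∣ p ∣ ℚ.- p)) k)))

*-nonNeg : ∀ {x y} → 0ℝ ≤ x → 0ℝ ≤ y → 0ℝ ≤ x * y
*-nonNeg {x} {y} hx hy = ∣x∣≃x⇒nonNeg (IsEquivalence.trans ≃-isEquivalence
  {j = ∣ x ∣ * ∣ y ∣}
  (pointwise⇒≃ λ n → ℚ.∣p*q∣≡∣p∣*∣q∣ (seq x n) (seq y n))
  (*-cong (nonNeg⇒∣x∣≃x hx) (nonNeg⇒∣x∣≃x hy)))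

+-nonNeg : ∀ {x y} → 0ℝ ≤ x → 0ℝ ≤ y → 0ℝ ≤ x + y
+-nonNeg {x} {y} hx hy = mk≤ λ ε 0<ε → map-eventually
  (λ n (p , q) → ℚ.≤-trans (ℚ.+-mono-≤ p q) (ℚ.≤-reflexive (eq ε (seq x n) (seq y n))))
  (∧-eventually (run≤ hx (½ ℚ.* ε) (half-pos 0<ε)) (run≤ hy (½ ℚ.* ε) (half-pos 0<ε)))
  where
  eq : ∀ ε p q → (p ℚ.+ ½ ℚ.* ε) ℚ.+ (q ℚ.+ ½ ℚ.* ε) ≡ p ℚ.+ q ℚ.+ ε
  eq ε p q = solve 3 (λ p q e →
    (p :+ con ½ :* e) :+ (q :+ con ½ :* e) := p :+ q :+ e) refl p q ε

sum-nonNeg : ∀ {n} (v : Vector ℝ n) → (∀ i → 0ℝ ≤ v i) → 0ℝ ≤ sum v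
sum-nonNeg {zero}  v h = mk≤ λ ε 0<ε →
  0 , λ _ _ → subst (0ℚ ℚ.≤_) (sym (ℚ.+-identityˡ ε)) (ℚ.<⇒≤ 0<ε)
sum-nonNeg {suc n} v h =
  +-nonNeg (h Fin.zero) (sum-nonNeg (λ i → v (Fin.suc i)) (λ i → h (Fin.suc i)))

-- The symbol set [n] is Fin n.
record Δ (n : ℕ) : Set where
  no-eta-equality
  field
    mass   : Vector ℝ n
    nonNeg : ∀ x → 0ℝ ≤ mass x
    sum≃1  : sum mass ≃ 1ℝ
open Δ public

infixl 6 _⊖_

_⊖_ : ∀ {n} → Δ n → Δ n → Vector ℝ n
(p ⊖ q) x = mass p x - mass q x

‖_‖₁ : ∀ {n} → Vector ℝ n → ℝ
‖_‖₁ {n} v = ∑[ x < n ] ∣ v x ∣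

-- φ x is the law of the random element that φ assigns to x, i.e. column x of
-- the column-stochastic matrix.
RandomizedMap : ℕ → ℕ → Set
RandomizedMap n m = Fin n → Δ m

infixr 9 _·_

_·_ : ∀ {n m} → RandomizedMap n m → Δ n → Δ m
_·_ {n} {m} φ q .mass   y = ∑[ x < n ] (mass q x * mass (φ x) y)
_·_ {n} {m} φ q .nonNeg y = sum-nonNeg (λ x → mass q x * mass (φ x) y)
  λ x → *-nonNeg (nonNeg q x) (nonNeg (φ x) y)
_·_ {n} {m} φ q .sum≃1    = begin
  ∑[ y < m ] ∑[ x < n ] (mass q x * mass (φ x) y)
    ≈⟨ ∑-comm (λ y x → mass q x * mass (φ x) y) ⟩
  ∑[ x < n ] ∑[ y < m ] (mass q x * mass (φ x) y)
    ≈⟨ sum-cong-≋ (λ x → R.sym (*-distribˡ-sum (mass q x) (mass (φ x)))) ⟩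
  ∑[ x < n ] (mass q x * sum (mass (φ x)))
    ≈⟨ sum-cong-≋ (λ x → R.*-congˡ (sum≃1 (φ x))) ⟩
  ∑[ x < n ] (mass q x * 1ℝ)
    ≈⟨ sum-cong-≋ (λ x → R.*-identityʳ (mass q x)) ⟩
  sum (mass q)
    ≈⟨ sum≃1 q ⟩
  1ℝ ∎
  where
  module R = CommutativeRing +-*-commutativeRing
  open import Relation.Binary.Reasoning.Setoid setoid

{-# OPTIONS --safe #-}

-- Take α = 1 and let the q range over the laws of a uniform draw from a list of n
-- symbols out of {0, …, n}, with repetition.  A constant list gives a point mass,
-- so flatness forces φ(x)(y) ≤ 2/m for all x and y.  A sign vector σ gives the list
-- whose i-th entry is i if σᵢ = + and 0 otherwise; the laws for σ and -σ are at
-- distance at least 1, while their images differ by (1/n) Σᵢ σᵢ vᵢ with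
-- vᵢ = φ(i) - φ(0).  For a suitable σ, depending on φ, Σ_y (Σᵢ σᵢ vᵢ(y))² is at most
-- Σᵢ Σ_y vᵢ(y)² = O(n/m), so by Cauchy–Schwarz the images are at distance O(1/√n).

module Submission where

open import Algebra.Bundles using (CommutativeRing)
open import Data.Bool.Base using (Bool; true; false; not)
open import Data.Fin.Base as Fin using (Fin; zero; suc)
import Data.Fin.Properties as Fin
open import Data.Integer.Base as ℤ using (+[1+_])
import Data.Integer.Properties as ℤ
open import Data.Nat.Base as ℕ using (ℕ; zero; suc; NonZero)
import Data.Nat.Properties as ℕ
open import Data.Product.Base using (∃; Σ-syntax; _×_; _,_; proj₁; proj₂)
open import Data.Rational.Base as ℚ using (ℚ; mkℚ; 0ℚ; 1ℚ; ½)
import Data.Rational.Properties as ℚ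
open import Data.Rational.Solver using (module +-*-Solver)
import Data.Rational.Unnormalised.Base as ℚᵘ
import Data.Rational.Unnormalised.Properties as ℚᵘ
open import Data.Sum.Base using (inj₁; inj₂)
open import Function.Base using (_∘_)
open import Relation.Binary.PropositionalEquality
  using (_≡_; _≢_; refl; sym; trans; cong; cong₂; subst; subst₂; module ≡-Reasoning)
open import Relation.Binary.Definitions using (Tri; tri<; tri≈; tri>)
open import Relation.Nullary.Decidable.Core using (Dec; yes; no)
open import Relation.Nullary.Negation using (¬_; contradiction)

module RationalBound where
  open import Defs using (module Lemmas)
  open Lemmas using (p≤∣p∣)
  open import Data.Rational.Base hiding (NonZero; 1/_)
  open import Data.Integer.Tactic.RingSolver using (solve-∀)
  open +-*-Solver using (solve; _:+_; _:*_; _:-_; :-_; _:=_; con)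
  open import Algebra.Properties.Semiring.Sum
    (CommutativeRing.semiring ℚ.+-*-commutativeRing) public
    using (sum; sum-syntax; sum-cong-≗; ∑-comm; ∑-distrib-+; *-distribˡ-sum; *-distribʳ-sum)

  -- Elementary inequalities over the rationals.

  x-y≥0⇒y≤x : ∀ {x y} → 0ℚ ≤ x - y → y ≤ x
  x-y≥0⇒y≤x {x} {y} h = subst₂ _≤_ (ℚ.+-identityˡ y)
    (solve 2 (λ x y → (x :- y) :+ y := x) refl x y) (ℚ.+-monoˡ-≤ y h)

  y≤x⇒x-y≥0 : ∀ {x y} → y ≤ x → 0ℚ ≤ x - y
  y≤x⇒x-y≥0 {x} {y} h = subst (_≤ x - y) (ℚ.+-inverseʳ y) (ℚ.+-monoˡ-≤ (- y) h)

  *-nonNeg : ∀ {x y} → 0ℚ ≤ x → 0ℚ ≤ y → 0ℚ ≤ x * y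
  *-nonNeg {x} {y} 0≤x 0≤y =
    subst (_≤ x * y) (ℚ.*-zeroʳ x) (ℚ.*-monoˡ-≤-nonNeg x {{nonNegative 0≤x}} 0≤y)

  *-positive : ∀ {x y} → 0ℚ < x → 0ℚ < y → 0ℚ < x * y
  *-positive {x} {y} 0<x 0<y =
    subst (_< x * y) (ℚ.*-zeroʳ x) (ℚ.*-monoʳ-<-pos x {{positive 0<x}} 0<y)

  square-nonNeg : ∀ x → 0ℚ ≤ x * x
  square-nonNeg x with ℚ.≤-total 0ℚ x
  ... | inj₁ 0≤x = *-nonNeg 0≤x 0≤x
  ... | inj₂ x≤0 = subst (0ℚ ≤_) (solve 1 (λ x → (:- x) :* (:- x) := x :* x) refl x)
                     (*-nonNeg (ℚ.neg-antimono-≤ x≤0) (ℚ.neg-antimono-≤ x≤0))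

  ∣x∣*∣x∣≡x*x : ∀ x → ∣ x ∣ * ∣ x ∣ ≡ x * x
  ∣x∣*∣x∣≡x*x x = trans (sym (ℚ.∣p*q∣≡∣p∣*∣q∣ x x)) (ℚ.0≤p⇒∣p∣≡p (square-nonNeg x))

  -x≤∣x∣ : ∀ x → - x ≤ ∣ x ∣
  -x≤∣x∣ x = subst (- x ≤_) (ℚ.∣-p∣≡∣p∣ x) (p≤∣p∣ (- x))

  -- The difference `b * b - x * x` factors as `(b - x) * (b + x)`, and the two hypotheses make both
  -- factors nonnegative.
  square-mono : ∀ {x b} → x ≤ b → - x ≤ b → x * x ≤ b * b
  square-mono {x} {b} x≤b -x≤b = x-y≥0⇒y≤x (subst (0ℚ ≤_)
    (solve 2 (λ x b → (b :- x) :* (b :- (:- x)) := b :* b :- x :* x) refl x b)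
    (*-nonNeg (y≤x⇒x-y≥0 x≤b) (y≤x⇒x-y≥0 -x≤b)))

  -- Expanding the square of `x - y` gives this. It stands in for Cauchy-Schwarz further on, so that
  -- no square root has to be taken.
  am-gm : ∀ x y → x * (y + y) ≤ x * x + y * y
  am-gm x y = x-y≥0⇒y≤x (subst (0ℚ ≤_)
    (solve 2 (λ x y → (x :- y) :* (x :- y) := (x :* x :+ y :* y) :- x :* (y :+ y)) refl x y)
    (square-nonNeg (x - y)))

  below-average : ∀ {p q c} → c ≤ p → p + q ≡ c + c → q ≤ c
  below-average {p} {q} {c} c≤p eq = x-y≥0⇒y≤x (subst (0ℚ ≤_) (begin
    p - c               ≡⟨ solve 3 (λ p q c → p :- c := (p :+ q) :- (c :+ q)) refl p q c ⟩
    (p + q) - (c + q)   ≡⟨ cong (_- (c + q)) eq ⟩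
    (c + c) - (c + q)   ≡⟨ solve 2 (λ q c → (c :+ c) :- (c :+ q) := c :- q) refl q c ⟩
    c - q               ∎) (y≤x⇒x-y≥0 c≤p))
    where open ≡-Reasoning

  -- Finite sums, unit fractions and means.

  sum-mono-≤ : ∀ {n} {u v : Fin n → ℚ} → (∀ i → u i ≤ v i) → sum u ≤ sum v
  sum-mono-≤ {zero}  h = ℚ.≤-refl
  sum-mono-≤ {suc n} h = ℚ.+-mono-≤ (h zero) (sum-mono-≤ (h ∘ suc))

  ∑-distrib-- : ∀ {n} (u v : Fin n → ℚ) → ∑[ i < n ] (u i - v i) ≡ sum u - sum v
  ∑-distrib-- {zero}  u v = refl
  ∑-distrib-- {suc n} u v = trans (cong ((u zero - v zero) +_) (∑-distrib-- (u ∘ suc) (v ∘ suc)))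
    (solve 4 (λ a b c d → (a :- b) :+ (c :- d) := (a :+ c) :- (b :+ d)) refl
      (u zero) (v zero) (sum (u ∘ suc)) (sum (v ∘ suc)))

  infix 12 1/_

  1/_ : (n : ℕ) .{{_ : NonZero n}} → ℚ
  1/ n = ℤ.+ 1 / n

  sum-1/ : ∀ n d .{{_ : NonZero d}} → ∑[ i < n ] (1/ d) ≡ ℤ.+ n / d
  sum-1/ zero    (suc d) = ℚ.fromℚᵘ-cong {ℚᵘ.mkℚᵘ (ℤ.+ 0) 0} {ℚᵘ.mkℚᵘ (ℤ.+ 0) d} (ℚᵘ.*≡* refl)
  sum-1/ (suc n) (suc d) = trans (cong (1/ suc d +_) (sum-1/ n (suc d)))
    (ℚ.toℚᵘ-injective (begin
      toℚᵘ (1/ suc d + ℤ.+ n / suc d)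
        ≈⟨ ℚ.toℚᵘ-homo-+ (1/ suc d) (ℤ.+ n / suc d) ⟩
      toℚᵘ (1/ suc d) ℚᵘ.+ toℚᵘ (ℤ.+ n / suc d)
        ≈⟨ ℚᵘ.+-cong (ℚ.toℚᵘ-fromℚᵘ (ℚᵘ.mkℚᵘ (ℤ.+ 1) d)) (ℚ.toℚᵘ-fromℚᵘ (ℚᵘ.mkℚᵘ (ℤ.+ n) d)) ⟩
      ℚᵘ.mkℚᵘ (ℤ.+ 1) d ℚᵘ.+ ℚᵘ.mkℚᵘ (ℤ.+ n) d
        ≈⟨ ℚᵘ.*≡* (eq (ℤ.+ n) (ℤ.+ suc d)) ⟩
      ℚᵘ.mkℚᵘ (ℤ.+ suc n) d
        ≈⟨ ℚ.toℚᵘ-fromℚᵘ (ℚᵘ.mkℚᵘ (ℤ.+ suc n) d) ⟨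
      toℚᵘ (ℤ.+ suc n / suc d) ∎))
    where
    open import Relation.Binary.Reasoning.Setoid ℚᵘ.≃-setoid
    eq : ∀ n d → (ℤ.+ 1 ℤ.* d ℤ.+ n ℤ.* d) ℤ.* d ≡ (ℤ.+ 1 ℤ.+ n) ℤ.* (d ℤ.* d)
    eq = solve-∀

  sum-1/≡1 : ∀ n .{{_ : NonZero n}} → ∑[ i < n ] (1/ n) ≡ 1ℚ
  sum-1/≡1 n@(suc k) = trans (sum-1/ n n)
    (ℚ.fromℚᵘ-cong {ℚᵘ.mkℚᵘ (ℤ.+ n) k} {ℚᵘ.1ℚᵘ} (ℚᵘ.*≡* (ℤ.*-comm (ℤ.+ n) (ℤ.+ 1))))

  0<1/ : ∀ n .{{_ : NonZero n}} → 0ℚ < 1/ n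
  0<1/ n = ℚ.positive⁻¹ (1/ n) {{ℚ.normalize-pos 1 n}}

  -- A positive fraction is at least one over its own denominator. The representation stores the
  -- denominator minus one, so `d` itself is the witness.
  archimedean : ∀ {p} → 0ℚ < p → ∃ λ k → 1/ suc k ≤ p
  archimedean {p@(mkℚ +[1+ a ] d _)} _ = d , ℚ.toℚᵘ-cancel-≤
    (ℚᵘ.≤-respˡ-≃ (ℚᵘ.≃-sym (ℚ.toℚᵘ-fromℚᵘ (ℚᵘ.mkℚᵘ (ℤ.+ 1) d)))
      (ℚᵘ.*≤* (ℤ.*-monoʳ-≤-nonNeg (ℤ.+ suc d) {ℤ.+ 1} {ℤ.+ suc a} (ℤ.+≤+ (ℕ.s≤s ℕ.z≤n)))))
  archimedean {mkℚ (ℤ.+ 0) _ _}      0<p = contradiction (positive 0<p) λ ()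
  archimedean {mkℚ ℤ.-[1+ _ ] _ _} 0<p = contradiction (positive 0<p) λ ()

  mean : ∀ {k} → (Fin (suc k) → ℚ) → ℚ
  mean {k} u = 1/ suc k * sum u

  mean-cong : ∀ {k} {u v : Fin (suc k) → ℚ} → (∀ i → u i ≡ v i) → mean u ≡ mean v
  mean-cong {k} h = cong (1/ suc k *_) (sum-cong-≗ h)

  mean-mono-≤ : ∀ {k} {u v : Fin (suc k) → ℚ} → (∀ i → u i ≤ v i) → mean u ≤ mean v
  mean-mono-≤ {k} h =
    ℚ.*-monoˡ-≤-nonNeg (1/ suc k) {{nonNegative (ℚ.<⇒≤ (0<1/ (suc k)))}} (sum-mono-≤ h)

  mean-- : ∀ {k} (u v : Fin (suc k) → ℚ) → mean u - mean v ≡ mean (λ i → u i - v i)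
  mean-- {k} u v = trans
    (solve 3 (λ w a b → w :* a :- w :* b := w :* (a :- b)) refl (1/ suc k) (sum u) (sum v))
    (cong (1/ suc k *_) (sym (∑-distrib-- u v)))

  mean-const : ∀ k c → mean {k} (λ _ → c) ≡ c
  mean-const k c = begin
    1/ suc k * ∑[ i < suc k ] c   ≡⟨ *-distribˡ-sum {suc k} (1/ suc k) (λ _ → c) ⟩
    ∑[ i < suc k ] (1/ suc k * c) ≡⟨ sum-cong-≗ {suc k} (λ _ → ℚ.*-comm (1/ suc k) c) ⟩
    ∑[ i < suc k ] (c * 1/ suc k) ≡⟨ *-distribˡ-sum {suc k} c (λ _ → 1/ suc k) ⟨
    c * ∑[ i < suc k ] 1/ suc k   ≡⟨ cong (c *_) (sum-1/≡1 (suc k)) ⟩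
    c * 1ℚ                        ≡⟨ ℚ.*-identityʳ c ⟩
    c                             ∎
    where open ≡-Reasoning

  -- Balancing signs, and two lists with nearby images.

  sign : Bool → ℚ
  sign true  = 1ℚ
  sign false = - 1ℚ

  -- Choose the signs one at a time: by the parallelogram law, one of s + v and s - v
  -- has squared norm at most that of s plus that of v.
  balance : ∀ {n m} (v : Fin n → Fin m → ℚ) → Σ[ σ ∈ (Fin n → Bool) ]
    ∑[ y < m ] (∑[ i < n ] (sign (σ i) * v i y) * ∑[ i < n ] (sign (σ i) * v i y))
      ≤ ∑[ i < n ] ∑[ y < m ] (v i y * v i y)
  balance {zero} {m} v = (λ ()) , ℚ.≤-reflexive (zeros m)
    where
    zeros : ∀ m → ∑[ y < m ] (0ℚ * 0ℚ) ≡ 0ℚ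
    zeros zero    = refl
    zeros (suc m) = trans (ℚ.+-identityˡ _) (zeros m)
  balance {suc n} {m} v with balance (v ∘ suc)
  ... | τ , ih = choose (ℚ.≤-total (A + B) (∑[ y < m ] (plus y * plus y)))
    where
    x s plus minus : Fin m → ℚ
    x = v zero
    s y = ∑[ i < n ] (sign (τ i) * v (suc i) y)
    plus  y = sign true  * x y + s y
    minus y = sign false * x y + s y
    A B : ℚ
    A = ∑[ y < m ] (x y * x y)
    B = ∑[ y < m ] (s y * s y)
    parallelogram : ∑[ y < m ] (plus y * plus y) + ∑[ y < m ] (minus y * minus y)
                      ≡ (A + B) + (A + B)
    parallelogram = begin
      ∑[ y < m ] (plus y * plus y) + ∑[ y < m ] (minus y * minus y)
        ≡⟨ ∑-distrib-+ _ (λ y → minus y * minus y) ⟨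
      ∑[ y < m ] (plus y * plus y + minus y * minus y)
        ≡⟨ sum-cong-≗ (λ y → solve 2 (λ x s →
             (con 1ℚ :* x :+ s) :* (con 1ℚ :* x :+ s) :+
             (:- con 1ℚ :* x :+ s) :* (:- con 1ℚ :* x :+ s)
             := (x :* x :+ s :* s) :+ (x :* x :+ s :* s)) refl (x y) (s y)) ⟩
      ∑[ y < m ] ((x y * x y + s y * s y) + (x y * x y + s y * s y))
        ≡⟨ ∑-distrib-+ (λ y → x y * x y + s y * s y) _ ⟩
      ∑[ y < m ] (x y * x y + s y * s y) + ∑[ y < m ] (x y * x y + s y * s y)
        ≡⟨ cong₂ _+_ (∑-distrib-+ _ (λ y → s y * s y)) (∑-distrib-+ _ (λ y → s y * s y)) ⟩
      (A + B) + (A + B) ∎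
      where open ≡-Reasoning
    choose : _ → _
    choose (inj₂ plus≤) =
      (λ { zero → true ; (suc i) → τ i }) , ℚ.≤-trans plus≤ (ℚ.+-monoʳ-≤ A ih)
    choose (inj₁ ≤plus) =
      (λ { zero → false ; (suc i) → τ i }) , ℚ.≤-trans minus≤ (ℚ.+-monoʳ-≤ A ih)
      where
      minus≤ : ∑[ y < m ] (minus y * minus y) ≤ A + B
      minus≤ = below-average ≤plus parallelogram

  pick : ∀ {n} → (Fin n → Bool) → Fin n → Fin (suc n)
  pick σ i with σ i
  ... | true  = suc i
  ... | false = zero

  -- Complementary sign vectors turn the difference of two means into a signed sum of the fixed
  -- vectors `a (suc i) - a zero`, which is the form that `balance` handles.
  pick-difference : ∀ {n} (a : Fin (suc n) → ℚ) (σ : Fin n → Bool) i →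
    a (pick σ i) - a (pick (not ∘ σ) i) ≡ sign (σ i) * (a (suc i) - a zero)
  pick-difference a σ i with σ i
  ... | true  = sym (ℚ.*-identityˡ _)
  ... | false = solve 2 (λ a b → b :- a := :- con 1ℚ :* (a :- b)) refl (a (suc i)) (a zero)

  -- AM-GM is applied at each `y` to the difference of the means and `μ * 1/ m`. With this scaling,
  -- both sums over the `m` points are multiples of `1/ m`. The parameter `μ` stays free until the
  -- target distance is known.
  close-pair : ∀ {k m} .{{_ : NonZero m}} (a : Fin (suc (suc k)) → Fin m → ℚ) μ →
    (∀ x y → - 1/ m ≤ a x y × a x y ≤ (ℤ.+ 3 / 1) * 1/ m) →
    Σ[ σ ∈ (Fin (suc k) → Bool) ]
      ∑[ y < m ] ∣ mean (λ i → a (pick σ i) y) - mean (λ i → a (pick (not ∘ σ) i) y) ∣ * (μ + μ)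
        ≤ (ℤ.+ 16 / 1) * 1/ suc k + μ * μ
  close-pair {k} {m} a μ flat with balance (λ i y → a (suc i) y - a zero y)
  -- The inequality is proved after multiplication by `r`, which is then cancelled.
  ... | σ , balanced = σ , ℚ.*-cancelʳ-≤-pos r {{positive (0<1/ m)}} (begin
    sum (λ y → ∣ d y ∣) * (μ + μ) * r
      ≡⟨ solve 3 (λ D μ r → D :* (μ :+ μ) :* r := (μ :* r :+ μ :* r) :* D) refl
           (sum (λ y → ∣ d y ∣)) μ r ⟩
    (μ * r + μ * r) * sum (λ y → ∣ d y ∣)
      ≡⟨ *-distribˡ-sum (μ * r + μ * r) (λ y → ∣ d y ∣) ⟩
    ∑[ y < m ] ((μ * r + μ * r) * ∣ d y ∣)
      ≤⟨ sum-mono-≤ (λ y → amgm y) ⟩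
    ∑[ y < m ] (w * w * (S y * S y) + μ * μ * r * r)
      ≡⟨ ∑-distrib-+ (λ y → w * w * (S y * S y)) (λ _ → μ * μ * r * r) ⟩
    ∑[ y < m ] (w * w * (S y * S y)) + ∑[ y < m ] (μ * μ * r * r)
      ≡⟨ cong₂ _+_ (*-distribˡ-sum (w * w) (λ y → S y * S y))
           (*-distribˡ-sum {m} (μ * μ * r) (λ _ → r)) ⟨
    w * w * ∑[ y < m ] (S y * S y) + μ * μ * r * ∑[ y < m ] r
      ≡⟨ cong₂ (λ p q → p + μ * μ * r * q) (ℚ.*-assoc w w _) (sum-1/≡1 m) ⟩
    w * (w * ∑[ y < m ] (S y * S y)) + μ * μ * r * 1ℚ
      -- One factor `w` turns the sum over `i` into a mean; the other survives and is the gain of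
      -- order 1/(k+1).
      ≤⟨ ℚ.+-monoˡ-≤ (μ * μ * r * 1ℚ) (w* (w* balanced)) ⟩
    w * mean (λ i → ∑[ y < m ] (v i y * v i y)) + μ * μ * r * 1ℚ
      ≤⟨ ℚ.+-monoˡ-≤ (μ * μ * r * 1ℚ) (w* (mean-mono-≤ energy)) ⟩
    w * mean {k} (λ _ → (ℤ.+ 16 / 1) * r) + μ * μ * r * 1ℚ
      ≡⟨ cong (λ z → w * z + μ * μ * r * 1ℚ) (mean-const k ((ℤ.+ 16 / 1) * r)) ⟩
    w * ((ℤ.+ 16 / 1) * r) + μ * μ * r * 1ℚ
      ≡⟨ solve 3 (λ w r μ → w :* (con (ℤ.+ 16 / 1) :* r) :+ μ :* μ :* r :* con 1ℚ
           := (con (ℤ.+ 16 / 1) :* w :+ μ :* μ) :* r) refl w r μ ⟩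
    ((ℤ.+ 16 / 1) * w + μ * μ) * r ∎)
    where
    open ℚ.≤-Reasoning
    r w : ℚ
    r = 1/ m
    w = 1/ suc k
    v : Fin (suc k) → Fin m → ℚ
    v i y = a (suc i) y - a zero y
    d S : Fin m → ℚ
    d y = mean (λ i → a (pick σ i) y) - mean (λ i → a (pick (not ∘ σ) i) y)
    S y = ∑[ i < suc k ] (sign (σ i) * v i y)
    w* : ∀ {p q} → p ≤ q → w * p ≤ w * q
    w* = ℚ.*-monoˡ-≤-nonNeg w {{nonNegative (ℚ.<⇒≤ (0<1/ (suc k)))}}
    d≡wS : ∀ y → d y ≡ w * S y
    d≡wS y = trans (mean-- (λ i → a (pick σ i) y) (λ i → a (pick (not ∘ σ) i) y))
               (mean-cong (pick-difference (λ x → a x y) σ))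
    amgm : ∀ y → (μ * r + μ * r) * ∣ d y ∣ ≤ w * w * (S y * S y) + μ * μ * r * r
    amgm y = subst₂ _≤_ (ℚ.*-comm ∣ d y ∣ _)
      (trans (cong (_+ μ * r * (μ * r)) (trans (∣x∣*∣x∣≡x*x (d y)) (cong₂ _*_ (d≡wS y) (d≡wS y))))
        (solve 4 (λ w s μ r → w :* s :* (w :* s) :+ μ :* r :* (μ :* r)
           := w :* w :* (s :* s) :+ μ :* μ :* r :* r) refl w (S y) μ r))
      (am-gm ∣ d y ∣ (μ * r))
    ∣difference∣≤ : ∀ {p q} → p ≤ (ℤ.+ 3 / 1) * r → - r ≤ q → p - q ≤ (ℤ.+ 4 / 1) * r
    ∣difference∣≤ {p} {q} p≤ ≤q = subst (p - q ≤_)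
      (solve 1 (λ r → con (ℤ.+ 3 / 1) :* r :+ (:- (:- r)) := con (ℤ.+ 4 / 1) :* r) refl r)
      (ℚ.+-mono-≤ p≤ (ℚ.neg-antimono-≤ ≤q))
    -- Two values in [-r, 3r] differ by at most 4r, and 16r² summed over the m = 1/r points gives
    -- 16r.
    energy : ∀ i → ∑[ y < m ] (v i y * v i y) ≤ (ℤ.+ 16 / 1) * r
    energy i = begin
      ∑[ y < m ] (v i y * v i y)
        ≤⟨ sum-mono-≤ (λ y → square-mono
             (∣difference∣≤ (proj₂ (flat (suc i) y)) (proj₁ (flat zero y)))
             (subst (_≤ (ℤ.+ 4 / 1) * r)
               (solve 2 (λ p q → q :- p := :- (p :- q)) refl (a (suc i) y) (a zero y))
               (∣difference∣≤ (proj₂ (flat zero y)) (proj₁ (flat (suc i) y))))) ⟩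
      ∑[ y < m ] ((ℤ.+ 4 / 1) * r * ((ℤ.+ 4 / 1) * r))
        ≡⟨ sum-cong-≗ {m} (λ _ → solve 1 (λ r →
             con (ℤ.+ 4 / 1) :* r :* (con (ℤ.+ 4 / 1) :* r) := con (ℤ.+ 16 / 1) :* r :* r) refl r) ⟩
      ∑[ y < m ] ((ℤ.+ 16 / 1) * r * r)
        ≡⟨ *-distribˡ-sum {m} ((ℤ.+ 16 / 1) * r) (λ _ → r) ⟨
      (ℤ.+ 16 / 1) * r * ∑[ y < m ] r
        ≡⟨ cong ((ℤ.+ 16 / 1) * r *_) (sum-1/≡1 m) ⟩
      (ℤ.+ 16 / 1) * r * 1ℚ
        ≡⟨ ℚ.*-identityʳ _ ⟩
      (ℤ.+ 16 / 1) * r ∎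

  pick-disjoint : ∀ {n} (σ : Fin n → Bool) i → pick σ i ≢ pick (not ∘ σ) i
  pick-disjoint σ i with σ i
  ... | true  = λ ()
  ... | false = λ ()

  -- Empirical distributions and their ℓ₁ distances.

  -- Recursion on both indices, rather than a test for equality, lets sums against `δ i` unfold
  -- together with `sum`.
  δ : ∀ {n} → Fin n → Fin n → ℚ
  δ zero    zero    = 1ℚ
  δ zero    (suc j) = 0ℚ
  δ (suc i) zero    = 0ℚ
  δ (suc i) (suc j) = δ i j

  δ-nonNeg : ∀ {n} (i j : Fin n) → 0ℚ ≤ δ i j
  δ-nonNeg zero    zero    = ℚ.<⇒≤ (ℚ.positive⁻¹ 1ℚ)
  δ-nonNeg zero    (suc j) = ℚ.≤-refl
  δ-nonNeg (suc i) zero    = ℚ.≤-refl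
  δ-nonNeg (suc i) (suc j) = δ-nonNeg i j

  sum-0* : ∀ {n} (a : Fin n → ℚ) → ∑[ x < n ] (0ℚ * a x) ≡ 0ℚ
  sum-0* a = trans (sym (*-distribˡ-sum 0ℚ a)) (ℚ.*-zeroˡ (sum a))

  sum-δ : ∀ {n} (i : Fin n) (a : Fin n → ℚ) → ∑[ x < n ] (δ i x * a x) ≡ a i
  sum-δ zero    a = trans (cong₂ _+_ (ℚ.*-identityˡ (a zero)) (sum-0* (a ∘ suc)))
                      (ℚ.+-identityʳ (a zero))
  sum-δ (suc i) a = trans (cong₂ _+_ (ℚ.*-zeroˡ (a zero)) (sum-δ i (a ∘ suc)))
                      (ℚ.+-identityˡ (a (suc i)))

  frequency : ∀ {k n} → (Fin (suc k) → Fin n) → Fin n → ℚ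
  frequency f x = mean (λ i → δ (f i) x)

  frequency-nonNeg : ∀ {k n} (f : Fin (suc k) → Fin n) x → 0ℚ ≤ frequency f x
  frequency-nonNeg {k} f x = subst (_≤ frequency f x) (mean-const k 0ℚ)
    (mean-mono-≤ (λ i → δ-nonNeg (f i) x))

  -- Interchange the two sums; each inner sum then picks out one value of `a`. Taking for `a` a row
  -- of the matrix of a randomized map computes the image of the distribution, and the constant 1
  -- gives its total mass.
  expectation : ∀ {k n} (f : Fin (suc k) → Fin n) (a : Fin n → ℚ) →
    ∑[ x < n ] (frequency f x * a x) ≡ mean (a ∘ f)
  expectation {k} {n} f a = begin
    ∑[ x < n ] (w * ∑[ i < suc k ] δ (f i) x * a x)
      ≡⟨ sum-cong-≗ (λ x → trans (ℚ.*-assoc w _ (a x))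
           (cong (w *_) (*-distribʳ-sum (a x) (λ i → δ (f i) x)))) ⟩
    ∑[ x < n ] (w * ∑[ i < suc k ] (δ (f i) x * a x))
      ≡⟨ *-distribˡ-sum w (λ x → ∑[ i < suc k ] (δ (f i) x * a x)) ⟨
    w * ∑[ x < n ] ∑[ i < suc k ] (δ (f i) x * a x)
      ≡⟨ cong (w *_) (∑-comm (λ x i → δ (f i) x * a x)) ⟩
    mean (λ i → ∑[ x < n ] (δ (f i) x * a x))
      ≡⟨ mean-cong (λ i → sum-δ (f i) a) ⟩
    mean (a ∘ f) ∎
    where
    open ≡-Reasoning
    w : ℚ
    w = 1/ suc k

  sum-frequency : ∀ {k n} (f : Fin (suc k) → Fin n) → sum (frequency f) ≡ 1ℚ
  sum-frequency {k} f = begin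
    sum (frequency f)                     ≡⟨ sum-cong-≗ (λ x → ℚ.*-identityʳ (frequency f x)) ⟨
    sum (λ x → frequency f x * 1ℚ)        ≡⟨ expectation f (λ _ → 1ℚ) ⟩
    mean {k} (λ _ → 1ℚ)                   ≡⟨ mean-const k 1ℚ ⟩
    1ℚ                                    ∎
    where open ≡-Reasoning

  distance : ∀ {n} → (Fin n → ℚ) → (Fin n → ℚ) → ℚ
  distance u v = sum (λ x → ∣ u x - v x ∣)

  distance-sym : ∀ {n} (u v : Fin n → ℚ) → distance u v ≡ distance v u
  distance-sym u v = sum-cong-≗ λ x → trans (sym (ℚ.∣-p∣≡∣p∣ (u x - v x)))
    (cong ∣_∣ (solve 2 (λ p q → :- (p :- q) := q :- p) refl (u x) (v x)))

  distance-frequency≤2 : ∀ {k n} (f g : Fin (suc k) → Fin n) →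
    distance (frequency f) (frequency g) ≤ 1ℚ + 1ℚ
  distance-frequency≤2 f g = begin
    distance (frequency f) (frequency g)
      ≤⟨ sum-mono-≤ (λ x → subst₂ (λ p q → ∣ frequency f x - frequency g x ∣ ≤ p + q)
           (ℚ.0≤p⇒∣p∣≡p (frequency-nonNeg f x)) (ℚ.0≤p⇒∣p∣≡p (frequency-nonNeg g x))
           (ℚ.∣p-q∣≤∣p∣+∣q∣ (frequency f x) (frequency g x))) ⟩
    sum (λ x → frequency f x + frequency g x)
      ≡⟨ ∑-distrib-+ (frequency f) (frequency g) ⟩
    sum (frequency f) + sum (frequency g)
      ≡⟨ cong₂ _+_ (sum-frequency f) (sum-frequency g) ⟩
    1ℚ + 1ℚ ∎
    where open ℚ.≤-Reasoning

  -- Pair the difference with the test vector that is sign (σ i) at suc i and 0 at zero.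
  1≤distance : ∀ {k} (σ : Fin (suc k) → Bool) {f g : Fin (suc k) → Fin (suc (suc k))} →
    (∀ i → f i ≡ pick σ i) → (∀ i → g i ≡ pick (not ∘ σ) i) →
    1ℚ ≤ distance (frequency f) (frequency g)
  1≤distance {k} σ {f} {g} f≡ g≡ = begin
    1ℚ
      ≡⟨ mean-const k 1ℚ ⟨
    mean {k} (λ _ → 1ℚ)
      ≡⟨ mean-cong gap ⟨
    mean (λ i → s (f i) - s (g i))
      ≡⟨ mean-- (s ∘ f) (s ∘ g) ⟨
    mean (s ∘ f) - mean (s ∘ g)
      ≡⟨ cong₂ _-_ (expectation f s) (expectation g s) ⟨
    sum (λ x → frequency f x * s x) - sum (λ x → frequency g x * s x)
      ≡⟨ ∑-distrib-- (λ x → frequency f x * s x) (λ x → frequency g x * s x) ⟨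
    sum (λ x → frequency f x * s x - frequency g x * s x)
      ≤⟨ sum-mono-≤ (λ x → test x (frequency f x) (frequency g x)) ⟩
    distance (frequency f) (frequency g) ∎
    where
    open ℚ.≤-Reasoning
    s : Fin (suc (suc k)) → ℚ
    s zero    = 0ℚ
    s (suc i) = sign (σ i)
    sign² : ∀ b → sign b * (sign b - 0ℚ) ≡ 1ℚ
    sign² true  = refl
    sign² false = refl
    gap : ∀ i → s (f i) - s (g i) ≡ 1ℚ
    gap i = trans (cong₂ (λ x y → s x - s y) (f≡ i) (g≡ i))
              (trans (pick-difference s σ i) (sign² (σ i)))
    sign-test : ∀ b p q → p * sign b - q * sign b ≤ ∣ p - q ∣
    sign-test true p q = subst (_≤ ∣ p - q ∣)
      (solve 2 (λ p q → p :- q := p :* con 1ℚ :- q :* con 1ℚ) refl p q) (p≤∣p∣ (p - q))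
    sign-test false p q = subst (_≤ ∣ p - q ∣)
      (solve 2 (λ p q → :- (p :- q) := p :* (:- con 1ℚ) :- q :* (:- con 1ℚ)) refl p q)
      (-x≤∣x∣ (p - q))
    test : ∀ x p q → p * s x - q * s x ≤ ∣ p - q ∣
    test zero p q = subst (_≤ ∣ p - q ∣)
      (solve 2 (λ p q → con 0ℚ := p :* con 0ℚ :- q :* con 0ℚ) refl p q) (ℚ.0≤∣p∣ (p - q))
    test (suc i) = sign-test (σ i)

  -- Bookkeeping of the slack, and the numerical contradiction.

  -- The factor `1ℚ - 1ℚ` is left unreduced to match the terms of `(1ℝ - 1ℝ) / m`, the lower
  -- flatness bound for α = 1.
  slack-lower : ∀ x r → (1ℚ - 1ℚ) * r ≤ x + r → - r ≤ x
  slack-lower x r h = subst₂ _≤_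
    (solve 1 (λ r → (con 1ℚ :- con 1ℚ) :* r :+ :- r := :- r) refl r)
    (solve 2 (λ x r → (x :+ r) :+ :- r := x) refl x r)
    (ℚ.+-monoˡ-≤ (- r) h)

  slack-upper : ∀ x r → x ≤ (1ℚ + 1ℚ) * r + r → x ≤ (ℤ.+ 3 / 1) * r
  slack-upper x r = subst (x ≤_)
    (solve 1 (λ r → (con 1ℚ :+ con 1ℚ) :* r :+ r := con (ℤ.+ 3 / 1) :* r) refl r)

  -- The product `c * d` is at least 2e; one `e` pays for the slack and the other remains as a lower
  -- bound for `D`.
  slack-distance : ∀ {c d D e} → 0ℚ < e → e + e ≤ c → 1ℚ ≤ d → c * d ≤ D + e → e ≤ D
  slack-distance {c} {d} {D} {e} 0<e 2e≤c 1≤d cd≤D+e = subst₂ _≤_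
    (solve 1 (λ e → (e :+ e) :+ :- e := e) refl e)
    (solve 2 (λ D e → (D :+ e) :+ :- e := D) refl D e)
    (ℚ.+-monoˡ-≤ (- e) (begin
      e + e      ≤⟨ 2e≤c ⟩
      c          ≡⟨ ℚ.*-identityʳ c ⟨
      c * 1ℚ     ≤⟨ ℚ.*-monoˡ-≤-nonNeg c {{nonNegative 0≤c}} 1≤d ⟩
      c * d      ≤⟨ cd≤D+e ⟩
      D + e      ∎))
    where
    open ℚ.≤-Reasoning
    0≤c : 0ℚ ≤ c
    0≤c = ℚ.≤-trans (ℚ.+-mono-≤ (ℚ.<⇒≤ 0<e) (ℚ.<⇒≤ 0<e)) 2e≤c

  -- The bound `e ≤ D` makes the left side at least 2e², whereas the right side is at most e²/2 +
  -- e². The constant 32 is chosen so that 16/32 = 1/2 leaves room for a strict inequality.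
  too-close : ∀ {w D e} → 0ℚ < e → w ≤ e * e * (ℤ.+ 1 / 32) → e ≤ D →
    ¬ (D * (e + e) ≤ (ℤ.+ 16 / 1) * w + e * e)
  too-close {w} {D} {e} 0<e w≤ e≤D close = ℚ.<-irrefl refl (begin-strict
    e * (e + e)
      ≤⟨ ℚ.*-monoʳ-≤-nonNeg (e + e) {{nonNegative (ℚ.+-mono-≤ (ℚ.<⇒≤ 0<e) (ℚ.<⇒≤ 0<e))}} e≤D ⟩
    D * (e + e)
      ≤⟨ close ⟩
    (ℤ.+ 16 / 1) * w + e * e
      ≤⟨ ℚ.+-monoˡ-≤ (e * e) (ℚ.*-monoˡ-≤-nonNeg (ℤ.+ 16 / 1) w≤) ⟩
    (ℤ.+ 16 / 1) * (e * e * (ℤ.+ 1 / 32)) + e * e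
      ≡⟨ solve 1 (λ s → con (ℤ.+ 16 / 1) :* (s :* con (ℤ.+ 1 / 32)) :+ s
           := con ½ :* s :+ s) refl (e * e) ⟩
    ½ * (e * e) + e * e
      <⟨ ℚ.+-monoˡ-< (e * e) (ℚ.*-monoˡ-<-pos (e * e) {{positive (*-positive 0<e 0<e)}} ½<1) ⟩
    1ℚ * (e * e) + e * e
      ≡⟨ solve 1 (λ e → con 1ℚ :* (e :* e) :+ e :* e := e :* (e :+ e)) refl e ⟩
    e * (e + e) ∎)
    where
    open ℚ.≤-Reasoning
    ½<1 : ½ < 1ℚ
    ½<1 = *<* (ℤ.+<+ (ℕ.s≤s (ℕ.s≤s ℕ.z≤n)))

open import Defs

module Q = RationalBound
open Lemmas using (∧-eventually; map-eventually; half-pos; half+half)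

-- From Cauchy sequences to their rational terms at one index.

-- Real addition acts termwise, so this is an exact equality of rationals and costs no slack.
seq-sum : ∀ {n} (v : Fin n → ℝ) t → seq (sum v) t ≡ Q.sum (λ i → seq (v i) t)
seq-sum {zero}  v t = refl
seq-sum {suc n} v t = cong (seq (v zero) t ℚ.+_) (seq-sum (v ∘ suc) t)

pointwise⇒≤ : ∀ {x y} → (∀ t → seq x t ℚ.≤ seq y t) → x ≤ y
pointwise⇒≤ {x} {y} h = mk≤ λ ε 0<ε → 0 , λ t _ → ℚ.≤-trans (h t)
  (subst (ℚ._≤ seq y t ℚ.+ ε) (ℚ.+-identityʳ (seq y t)) (ℚ.+-monoʳ-≤ (seq y t) (ℚ.<⇒≤ 0<ε)))

-- Finitely many thresholds have a maximum. This lets all the real hypotheses be read off at a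
-- single index.
eventually-∀ : ∀ {n} {P : Fin n → ℕ → Set} →
  (∀ i → Eventually (P i)) → Eventually λ t → ∀ i → P i t
eventually-∀ {zero}  h = 0 , λ _ _ ()
eventually-∀ {suc n} h = map-eventually
  (λ { t (p , q) zero → p ; t (p , q) (suc i) → q i })
  (∧-eventually (h zero) (eventually-∀ (h ∘ suc)))

-- The threshold must be fixed before a proof of `A` is supplied, hence the case split on its
-- decision.
eventually-→ : ∀ {A : Set} {P : ℕ → Set} → Dec A → (A → Eventually P) →
  Eventually λ t → A → P t
eventually-→ (yes a) h = map-eventually (λ _ p _ → p) (h a)
eventually-→ (no ¬a) h = 0 , λ _ _ a → contradiction a ¬a

empirical : ∀ {k n} → (Fin (suc k) → Fin n) → Δ n
empirical f .mass   x = fromℚ (Q.frequency f x)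
empirical f .nonNeg x = pointwise⇒≤ λ _ → Q.frequency-nonNeg f x
empirical f .sum≃1    = pointwise⇒≃ λ t →
  trans (seq-sum (mass (empirical f)) t) (Q.sum-frequency f)

seq-‖⊖‖ : ∀ {n} (p q : Δ n) t →
  seq ‖ p ⊖ q ‖₁ t ≡ Q.distance (λ x → seq (mass p x) t) (λ x → seq (mass q x) t)
seq-‖⊖‖ p q t = seq-sum (λ x → ∣ (p ⊖ q) x ∣) t

-- The weights of `empirical f` are constant sequences, so at each index the image is exactly the
-- mean of the selected columns.
seq-push : ∀ {k n m} (φ : RandomizedMap n m) (f : Fin (suc k) → Fin n) y t →
  seq (mass (φ · empirical f) y) t ≡ Q.mean (λ i → seq (mass (φ (f i)) y) t)
seq-push φ f y t = trans (seq-sum (λ x → mass (empirical f) x * mass (φ x) y) t)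
  (Q.expectation f (λ x → seq (mass (φ x) y) t))

-- At a fixed index t of the Cauchy sequences the real hypotheses become rational ones
-- with slack: 1/m in flatness, so that φ(x)(y) lies between -1/m and 3/m, and e in
-- the distance bound.
no-flattening : ∀ {k K} (samples : Fin K → Fin (suc k) → Fin (suc (suc k))) →
  (∀ f → ∃ λ j → ∀ i → samples j i ≡ f i) →
  ∀ {m} .{{_ : NonZero m}} (φ : RandomizedMap (suc (suc k)) m) t c e →
  let q : Fin K → Δ (suc (suc k))
      q j = empirical (samples j)
  in
  0ℚ ℚ.< e → Q.1/ suc k ℚ.≤ e ℚ.* e ℚ.* (ℤ.+ 1 ℚ./ 32) → e ℚ.+ e ℚ.≤ c →
  (∀ (j : Fin K) (y : Fin m) →
       seq ((1ℝ - 1ℝ) / m) t ℚ.≤ seq (mass (φ · q j) y) t ℚ.+ Q.1/ m ×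
       seq (mass (φ · q j) y) t ℚ.≤ seq ((1ℝ + 1ℝ) / m) t ℚ.+ Q.1/ m) →
  ¬ (∀ (j j′ : Fin K) → j Fin.< j′ →
       c ℚ.* seq ‖ q j ⊖ q j′ ‖₁ t ℚ.≤ seq ‖ φ · q j ⊖ φ · q j′ ‖₁ t ℚ.+ e)
no-flattening {k} {K} samples surjective {m} φ t c e 0<e 1/n≤ 2e≤c flat far =
  Q.too-close {D = D} 0<e 1/n≤
    (Q.slack-distance {d = d} {D} 0<e 2e≤c
      (Q.1≤distance σ (samples-index (Q.pick σ)) (samples-index (Q.pick (not ∘ σ))))
      (far-pair (Fin.<-cmp j j′)))
    (proj₂ pair)
  where
  q : Fin K → Δ (suc (suc k))
  q j = empirical (samples j)
  index : (Fin (suc k) → Fin (suc (suc k))) → Fin K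
  index f = proj₁ (surjective f)
  -- Lists are recovered from their codes only pointwise, which is why `1≤distance` accepts lists
  -- pointwise equal to `pick σ`.
  samples-index : ∀ f i → samples (index f) i ≡ f i
  samples-index f = proj₂ (surjective f)
  r : ℚ
  r = Q.1/ m
  a : Fin (suc (suc k)) → Fin m → ℚ
  a x y = seq (mass (φ x) y) t
  image : ∀ f y → seq (mass (φ · q (index f)) y) t ≡ Q.mean (λ i → a (f i) y)
  image f y = trans (seq-push φ (samples (index f)) y t)
    (Q.mean-cong (λ i → cong (λ x → a x y) (samples-index f i)))
  -- The empirical distribution of a constant list is a point mass.
  flat′ : ∀ x y → ℚ.- r ℚ.≤ a x y × a x y ℚ.≤ (ℤ.+ 3 ℚ./ 1) ℚ.* r
  flat′ x y =
    Q.slack-lower (a x y) r (subst (λ z → (1ℚ ℚ.- 1ℚ) ℚ.* r ℚ.≤ z ℚ.+ r) at-x (proj₁ bounds)) ,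
    Q.slack-upper (a x y) r (subst (ℚ._≤ (1ℚ ℚ.+ 1ℚ) ℚ.* r ℚ.+ r) at-x (proj₂ bounds))
    where
    bounds = flat (index (λ _ → x)) y
    at-x : seq (mass (φ · q (index (λ _ → x))) y) t ≡ a x y
    at-x = trans (image (λ _ → x) y) (Q.mean-const k (a x y))
  -- The free parameter `μ` becomes `e`, the lower bound that the image distance will be shown to
  -- satisfy.
  pair = Q.close-pair a e flat′
  σ : Fin (suc k) → Bool
  σ = proj₁ pair
  j j′ : Fin K
  j  = index (Q.pick σ)
  j′ = index (Q.pick (not ∘ σ))
  d D : ℚ
  d = Q.distance (Q.frequency (samples j)) (Q.frequency (samples j′))
  D = Q.distance (λ y → Q.mean (λ i → a (Q.pick σ i) y))
                 (λ y → Q.mean (λ i → a (Q.pick (not ∘ σ) i) y))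
  image-distance : seq ‖ φ · q j ⊖ φ · q j′ ‖₁ t ≡ D
  image-distance = trans (seq-‖⊖‖ (φ · q j) (φ · q j′) t)
    (Q.sum-cong-≗ λ y → cong₂ (λ u v → ℚ.∣ u ℚ.- v ∣)
      (image (Q.pick σ) y) (image (Q.pick (not ∘ σ)) y))
  norm-sym : ∀ {n} (p p′ : Δ n) → seq ‖ p′ ⊖ p ‖₁ t ≡ seq ‖ p ⊖ p′ ‖₁ t
  norm-sym p p′ = trans (seq-‖⊖‖ p′ p t)
    (trans (Q.distance-sym (λ x → seq (mass p′ x) t) _) (sym (seq-‖⊖‖ p p′ t)))
  -- The hypothesis covers only increasing pairs of indices, so the symmetry of the norm handles the
  -- other order. Equal indices are impossible because the two lists already differ at position
  -- `zero`.
  far-pair : Tri (j Fin.< j′) (j ≡ j′) (j′ Fin.< j) → c ℚ.* d ℚ.≤ D ℚ.+ e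
  far-pair (tri< j<j′ _ _) = subst₂ (λ u v → c ℚ.* u ℚ.≤ v ℚ.+ e)
    (seq-‖⊖‖ (q j) (q j′) t) image-distance (far j j′ j<j′)
  far-pair (tri> _ _ j′<j) = subst₂ (λ u v → c ℚ.* u ℚ.≤ v ℚ.+ e)
    (trans (norm-sym (q j) (q j′)) (seq-‖⊖‖ (q j) (q j′) t))
    (trans (norm-sym (φ · q j) (φ · q j′)) image-distance) (far j′ j j′<j)
  far-pair (tri≈ _ j≡j′ _) = contradiction
    (trans (sym (samples-index (Q.pick σ) zero))
      (trans (cong (λ i → samples i zero) j≡j′)
        (samples-index (Q.pick (not ∘ σ)) zero)))
    (Q.pick-disjoint σ zero)

mainTheorem5 : (c C : ℝ) → 0ℝ < c → c ≤ C →
    Σ[ n ∈ ℕ ] Σ[ k ∈ ℕ ] Σ[ α ∈ ℝ ] Σ[ q ∈ (Fin k → Δ n) ]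
    (NonZero n × NonZero k × 0ℝ < α ×
    (∀ j j′ → ‖ q j ⊖ q j′ ‖₁ ≤ 2ℝ * α) ×
    ¬ (Σ[ m ∈ ℕ ] Σ[ m≢0 ∈ NonZero m ] Σ[ φ ∈ RandomizedMap n m ]
    let instance _ = m≢0 in
    (∀ j y → (1ℝ - α) / m ≤ mass (φ · q j) y × mass (φ · q j) y ≤ (1ℝ + α) / m) ×
    (∀ j j′ → j Fin.< j′ →
    c * ‖ q j ⊖ q j′ ‖₁ ≤ ‖ φ · q j ⊖ φ · q j′ ‖₁ ×
    ‖ φ · q j ⊖ φ · q j′ ‖₁ ≤ C * ‖ q j ⊖ q j′ ‖₁)))
mainTheorem5 c C (mk< (ε , 0<ε , c≥ε)) _ =
  suc (suc k) , K , 1ℝ , q ,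
  _ , ℕ.m^n≢0 (suc (suc k)) (suc k) , mk< (1ℚ , ℚ.positive⁻¹ 1ℚ , 0 , λ _ _ → ℚ.≤-refl) ,
  diameter , refute
  where
  -- Half of the gap below `c`: eventually the terms of `c` are at least 2e, as `slack-distance`
  -- requires.
  e : ℚ
  e = ½ ℚ.* ε
  0<e : 0ℚ ℚ.< e
  0<e = half-pos 0<ε
  0<e²/32 : 0ℚ ℚ.< e ℚ.* e ℚ.* (ℤ.+ 1 ℚ./ 32)
  0<e²/32 = Q.*-positive (Q.*-positive 0<e 0<e) (Q.0<1/ 32)
  k K : ℕ
  -- The list length k+1 is large enough that 1/(k+1) is at most e²/32, the threshold of
  -- `too-close`.
  k = proj₁ (Q.archimedean 0<e²/32)
  -- The number of all lists of length k+1 over k+2 symbols. All sign vectors must be represented,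
  -- since the good one depends on a map that is given only later.
  K = suc (suc k) ℕ.^ suc k
  samples : Fin K → Fin (suc k) → Fin (suc (suc k))
  samples = Fin.finToFun
  q : Fin K → Δ (suc (suc k))
  q j = empirical (samples j)
  diameter : ∀ j j′ → ‖ q j ⊖ q j′ ‖₁ ≤ 2ℝ * 1ℝ
  diameter j j′ = pointwise⇒≤ λ t → subst (ℚ._≤ seq (2ℝ * 1ℝ) t)
    (sym (seq-‖⊖‖ (q j) (q j′) t))
    (Q.distance-frequency≤2 (samples j) (samples j′))
  refute : _
  refute (m , m≢0 , φ , flat , far) =
    let instance _ = m≢0
        -- A common index at which the bound on `c`, flatness with slack 1/m, and the lower distance
        -- bounds with slack `e` all hold.
        T , at = ∧-eventually c≥ε (∧-eventually
          (eventually-∀ λ j → eventually-∀ λ y → ∧-eventually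
            (run≤ (proj₁ (flat j y)) (Q.1/ m) (Q.0<1/ m))
            (run≤ (proj₂ (flat j y)) (Q.1/ m) (Q.0<1/ m)))
          (eventually-∀ λ j → eventually-∀ λ j′ → eventually-→ (j Fin.<? j′)
            λ j<j′ → run≤ (proj₁ (far j j′ j<j′)) e 0<e))
        ε≤c , flat-at , far-at = at T ℕ.≤-refl
    in no-flattening samples (λ f → Fin.funToFin f , Fin.finToFun-funToFin f)
         φ T (seq c T) e 0<e (proj₂ (Q.archimedean 0<e²/32))
         (subst (ℚ._≤ seq c T) (trans (ℚ.+-identityˡ ε) (sym (half+half ε))) ε≤c)
         flat-at far-at
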